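{- If $G$ and $H$ are R-cores that are weakly relationally equivalent to each other, then $G$ and $H$ are isomorphic.
   Context: Graphs are finite and undirected, loops allowed. For a finite set $B$ and a relation $R\subseteq V_G\times B$ with full image (every $b\in B$ has some $v$ with $(v,b)\in R$), $G\ast R$ is the graph with vertex set $B$ and edge set $\{(a,b)\in B\times B: \exists (u,v)\in E_G,\ (u,a)\in R,\ (v,b)\in R\}$. All relations here are required to have full domain (every $v\in V_G$ is related to some $b\in B$). $G$ and $H$ are weakly relationally equivalent if there are relations $R\subseteq V_G\times V_H$ and $S\subseteq V_H\times V_G$ with $G\ast R=H$ and $H\ast S=G$; this is an equivalence relation. A graph is an R-core if it has the minimum number of vertices among all graphs in its weak relational equivalence class. -}

module Defs where

open import Level using (0ℓ)
open import Data.Nat using (ℕ; _≤_)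
open import Data.Fin using (Fin)
open import Data.Fin.Properties using (any?)
open import Data.Fin.Permutation using (Permutation; _⟨$⟩ʳ_)
open import Data.Product using (∃; ∃-syntax; _×_; _,_)
open import Function.Bundles as Fun using ()
open import Relation.Binary using (REL; Rel; Decidable; Symmetric; _⇔_)
open import Relation.Nullary.Decidable using (_×-dec_)

-- Vertex sets are Fin n.  Edge sets, like the relations below, are subsets of
-- a finite product, hence decidable.  Loops are allowed.
record Graph (n : ℕ) : Set₁ where
  field
    Edge  : Rel (Fin n) 0ℓ
    edge? : Decidable Edge
    symm  : Symmetric Edge

open Graph public

record FullRelation (m n : ℕ) : Set₁ where
  field
    Related    : REL (Fin m) (Fin n) 0ℓ
    related?   : Decidable Related
    fullDomain : ∀ v → ∃[ b ] Related v b
    fullImage  : ∀ b → ∃[ v ] Related v b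

open FullRelation public

infixl 7 _∗_
infix  4 _≐_ _WeaklyEquivalent_ _≅_

_∗_ : ∀ {m n} → Graph m → FullRelation m n → Graph n
Edge  (G ∗ R) a b = ∃[ u ] ∃[ v ] (Edge G u v × Related R u a × Related R v b)
edge? (G ∗ R) a b = any? λ u → any? λ v →
  edge? G u v ×-dec related? R u a ×-dec related? R v b
symm  (G ∗ R) (u , v , e , r , s) = v , u , symm G e , s , r

_≐_ : ∀ {n} → Graph n → Graph n → Set
G ≐ H = Edge G ⇔ Edge H

_WeaklyEquivalent_ : ∀ {m n} → Graph m → Graph n → Set₁
_WeaklyEquivalent_ {m} {n} G H =
  (∃ λ (R : FullRelation m n) → G ∗ R ≐ H) ×
  (∃ λ (S : FullRelation n m) → H ∗ S ≐ G)

RCore : ∀ {n} → Graph n → Set₁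
RCore {n} G = ∀ {k} (K : Graph k) → G WeaklyEquivalent K → n ≤ k

_≅_ : ∀ {m n} → Graph m → Graph n → Set
_≅_ {m} {n} G H = ∃ λ (φ : Permutation m n) →
  ∀ u v → Edge G u v Fun.⇔ Edge H (φ ⟨$⟩ʳ u) (φ ⟨$⟩ʳ v)

{-# OPTIONS --safe #-}

-- If a relation R between the vertex sets factors as R = Q ; T through k
-- points, then G ∗ Q is weakly equivalent to G, so for an R-core G on m
-- vertices k ≥ m.  By the Kőnig–Hall argument a relation that contains no
-- injection factors through fewer than m points: a vertex cover of R serves
-- as the middle set.  Hence the two relations between R-cores contain
-- injections f and g, which are graph homomorphisms.  Each pair of vertices is
-- periodic under g ∘ f, so f also reflects edges, and f is onto because each
-- vertex of H is periodic under f ∘ g.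
module Submission where

open import Data.Nat using (ℕ; zero; suc; _<_; s≤s)
open import Data.Nat.Properties using (≤-refl; <⇒≱; n<1+n)
open import Data.Nat.GeneralisedArithmetic using (fold)
open import Data.Fin using (Fin; zero; suc; toℕ; combine)
open import Data.Fin.Permutation using (permutation)
open import Data.Fin.Properties
  using (_≟_; any?; pigeonhole; combine-injective)
open import Data.Fin.Subset using (Subset; _∈_; _∉_; _∪_; _⊃_; ⁅_⁆)
open import Data.Fin.Subset.Induction using (Acc; acc; ⊃-wellFounded)
open import Data.Fin.Subset.Properties
  using (_∈?_; x∈⁅x⁆; x∈⁅y⁆⇒x≡y; p⊆p∪q; q⊆p∪q; x∈p∪q⁻)
open import Data.Product using (∃-syntax; _×_; _,_; proj₁; proj₂; map)
open import Data.Product.Properties using (×-≡,≡→≡)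
open import Data.Empty using (⊥)
open import Data.Unit using (⊤; tt)
open import Data.Sum using (_⊎_; inj₁; inj₂)
open import Data.Vec.Functional using (updateAt; _∷_)
open import Data.Vec.Functional.Properties
  using (updateAt-updates; updateAt-minimal)
open import Function using (_∘_; const; id; mk⇔)
open import Function.Definitions using (Injective)
open import Level using (0ℓ)
open import Relation.Binary using (REL; Decidable; _⇔_)
open import Relation.Binary.Construct.Composition using (_;_)
open import Relation.Binary.PropositionalEquality
  using (_≡_; _≢_; refl; sym; trans; cong; subst)
open import Relation.Nullary using (¬_; yes; no; contradiction)
open import Relation.Nullary.Decidable
  using (_×-dec_; _⊎-dec_; ¬?; decidable-stable)
open import Relation.Unary using (Pred)
open import Defs

private
  variable
    m n p : ℕ

-- Periodic points of injective self-maps of finite sets.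

module _ {A : Set} {φ : A → A} (φ-injective : Injective _≡_ _≡_ φ) where

  -- Injectivity cancels the `i` applications of `φ` common to both sides; at least one is left on
  -- the right.
  fold-collision : ∀ {x i j} → i < j → fold x φ i ≡ fold x φ j →
                   ∃[ l ] fold x φ (suc l) ≡ x
  fold-collision {i = zero}  {suc j} _         eq = j , sym eq
  fold-collision {i = suc i} {suc j} (s≤s i<j) eq =
    fold-collision i<j (φ-injective eq)

  -- The embedding `e` expresses finiteness: two of the first `N + 1` iterates of `x` collide.
  periodic : ∀ {N} {e : A → Fin N} → Injective _≡_ _≡_ e →
             ∀ x → ∃[ l ] fold x φ (suc l) ≡ x
  periodic {N} {e} e-injective x
    with i , j , i<j , eq ← pigeonhole (n<1+n N) (λ i → e (fold x φ (toℕ i)))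
    = fold-collision i<j (e-injective eq)

  -- Since `x` is periodic, it is an iterate of `φ x`; invariance carries `P` around the cycle.
  reflects-invariant : ∀ {N} {e : A → Fin N} → Injective _≡_ _≡_ e →
                       {P : Pred A 0ℓ} → (∀ {x} → P x → P (φ x)) →
                       ∀ {x} → P (φ x) → P x
  reflects-invariant e-injective {P} invariant {x} Pφx
    with l , eq ← periodic e-injective x
    = subst P eq (iterated l)
    where
    iterated : ∀ l → P (fold x φ (suc l))
    iterated zero    = Pφx
    iterated (suc l) = invariant (iterated l)

-- Kőnig-Hall alternative: injections and small factorisations.

Matching : REL (Fin m) (Fin n) 0ℓ → Set
Matching P = ∃[ f ] Injective _≡_ _≡_ f × (∀ u → P u (f u))

-- `T` is a bare relation, because restricting to some rows may leave columns empty. Its full image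
-- is recovered in `smallFactorisation⇒smaller`.
record SmallFactorisation (P : REL (Fin m) (Fin n) 0ℓ) : Set₁ where
  field
    {size} : ℕ
    size<m : size < m
    Q      : FullRelation m size
    T      : REL (Fin size) (Fin n) 0ℓ
    T?     : Decidable T
    total  : ∀ i → ∃[ b ] T i b
    factor : P ⇔ (Related Q ; T)

-- Alternating paths from the one unmatched row `zero`.

module Augmentation
  {P : REL (Fin (suc m)) (Fin n) 0ℓ} (P? : Decidable P)
  (P-total : ∀ u → ∃[ b ] P u b)
  (f : Fin m → Fin n) (f-injective : Injective _≡_ _≡_ f)
  (f-related : ∀ i → P (suc i) (f i))
  where

  -- A matching of all rows but u, obtained from f by changes along an
  -- alternating path inside A.
  record MatchingOff (A : Subset (suc m)) (u : Fin (suc m)) : Set where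
    field
      g         : Fin (suc m) → Fin n
      injective : ∀ {v w} → v ≢ u → w ≢ u → g v ≡ g w → v ≡ w
      related   : ∀ {v} → v ≢ u → P v (g v)
      image     : ∀ {v} → v ≢ u → ∃[ i ] f i ≡ g v
      unchanged : ∀ {i} → suc i ∉ A → g (suc i) ≡ f i

  initial : MatchingOff ⁅ zero ⁆ zero
  initial = record
    { g         = g
    ; injective = initial-injective
    ; related   = λ {v} → initial-related v
    ; image     = λ {v} → initial-image v
    ; unchanged = λ _ → refl
    }
    where
    g : Fin (suc m) → Fin n
    -- The value at `zero` is a placeholder: this is the exempt row.
    g = proj₁ (P-total zero) ∷ f

    initial-injective : ∀ {v w} → v ≢ zero → w ≢ zero → g v ≡ g w → v ≡ w
    initial-injective {zero}          0≢0 _   _  = contradiction refl 0≢0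
    initial-injective {suc _} {zero}  _   0≢0 _  = contradiction refl 0≢0
    initial-injective {suc _} {suc _} _   _   eq = cong suc (f-injective eq)

    initial-related : ∀ v → v ≢ zero → P v (g v)
    initial-related zero    0≢0 = contradiction refl 0≢0
    initial-related (suc i) _   = f-related i

    initial-image : ∀ v → v ≢ zero → ∃[ i ] f i ≡ g v
    initial-image zero    0≢0 = contradiction refl 0≢0
    initial-image (suc i) _   = i , refl

  weaken : ∀ {A B u} → (∀ {v} → v ∈ A → v ∈ B) → MatchingOff A u → MatchingOff B u
  weaken A⊆B M = record { MatchingOff M
    ; unchanged = λ i∉B → MatchingOff.unchanged M (i∉B ∘ A⊆B) }

  module Reassign {A : Subset (suc m)} {u : Fin (suc m)}
                  (M : MatchingOff A u) {b : Fin n} (Pub : P u b) where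
    open MatchingOff M

    g′ : Fin (suc m) → Fin n
    g′ = updateAt g u (const b)

    at-u : g′ u ≡ b
    at-u = updateAt-updates u g

    off-u : ∀ {v} → v ≢ u → g′ v ≡ g v
    off-u {v} = updateAt-minimal v u g

    g′-related : ∀ v → P v (g′ v)
    g′-related v with v ≟ u
    ... | yes refl = subst (P u) (sym at-u) Pub
    ... | no  v≢u  = subst (P v) (sym (off-u v≢u)) (related v≢u)

    -- The conditions are imposed on `v` and `w` separately, so that one lemma serves both
    -- injectivity everywhere and injectivity off a new exempt row.
    g′-injective : ∀ {v w} → (v ≢ u → g v ≢ b) → (w ≢ u → g w ≢ b) →
                   g′ v ≡ g′ w → v ≡ w
    g′-injective {v} {w} gv≢b gw≢b eq with v ≟ u | w ≟ u
    ... | yes refl | yes refl = refl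
    ... | yes refl | no  w≢u  =
      contradiction (trans (sym (off-u w≢u)) (trans (sym eq) at-u)) (gw≢b w≢u)
    ... | no  v≢u  | yes refl =
      contradiction (trans (sym (off-u v≢u)) (trans eq at-u)) (gv≢b v≢u)
    ... | no  v≢u  | no  w≢u  =
      injective v≢u w≢u (trans (sym (off-u v≢u)) (trans eq (off-u w≢u)))

    -- The alternating path ends in a free column: off `u`, `g` takes only values of `f`, hence
    -- never `b`.
    complete : ¬ (∃[ i ] f i ≡ b) → Matching P
    complete b∉f = g′ , g′-injective avoids avoids , g′-related
      where
      avoids : ∀ {v} → v ≢ u → g v ≢ b
      avoids v≢u refl = b∉f (image v≢u)

    -- Row `suc i` lies outside `A`, so it still holds `f i`, which is `b`. Handing `b` to `u` makes
    -- `suc i` the exempt row. The only changed row, `u`, is in `A`, so rows outside the larger set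
    -- keep their columns.
    extend : ∀ {i} → u ∈ A → suc i ∉ A → f i ≡ b →
             MatchingOff (A ∪ ⁅ suc i ⁆) (suc i)
    extend {i} u∈A i∉A fi≡b = record
      { g         = g′
      ; injective = λ v≢i w≢i → g′-injective (avoids v≢i) (avoids w≢i)
      ; related   = λ {v} _ → g′-related v
      ; image     = λ _ → g′-image
      ; unchanged = λ {j} j∉ →
          trans (off-u λ { refl → j∉ (p⊆p∪q _ u∈A) }) (unchanged (j∉ ∘ p⊆p∪q _))
      }
      where
      i≢u : suc i ≢ u
      i≢u refl = i∉A u∈A

      avoids : ∀ {v} → v ≢ suc i → v ≢ u → g v ≢ b
      avoids v≢i v≢u gv≡b =
        v≢i (injective v≢u i≢u (trans gv≡b (sym (trans (unchanged i∉A) fi≡b))))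

      g′-image : ∀ {v} → ∃[ j ] f j ≡ g′ v
      g′-image {v} with v ≟ u
      ... | yes refl = i , trans fi≡b (sym at-u)
      ... | no  v≢u  = map id (λ eq → trans eq (sym (off-u v≢u))) (image v≢u)

  -- If the columns adjacent to A are all matched by f to rows in A, then these
  -- columns and the rows outside A cover P.  The m points of the cover are
  -- indexed by Fin m: i is the column f i if suc i ∈ A, and the row suc i if not.
  factorise : (A : Subset (suc m)) → zero ∈ A →
              (∀ {u b} → u ∈ A → P u b → ∃[ i ] suc i ∈ A × f i ≡ b) →
              SmallFactorisation P
  factorise A 0∈A closed = record
    { size<m = ≤-refl
    ; Q      = record
        { Related    = Row
        ; related?   = λ u i →
            (suc i ∈? A ×-dec u ∈? A ×-dec P? u (f i)) ⊎-dec
            (¬? (suc i ∈? A) ×-dec u ≟ suc i)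
        ; fullDomain = λ u → map id proj₁ (through (proj₂ (P-total u)))
        ; fullImage  = λ i → suc i , diagonal i
        }
    ; T      = Column
    ; T?     = λ i b →
        (suc i ∈? A ×-dec f i ≟ b) ⊎-dec (¬? (suc i ∈? A) ×-dec P? (suc i) b)
    ; total  = column-total
    ; factor = through , λ where
        (_ , inj₁ (_   , _ , Pub) , inj₁ (_ , refl)) → Pub
        (_ , inj₁ (i∈A , _)       , inj₂ (i∉A , _))  → contradiction i∈A i∉A
        (_ , inj₂ (i∉A , _)       , inj₁ (i∈A , _))  → contradiction i∈A i∉A
        (_ , inj₂ (_   , refl)    , inj₂ (_ , Pub))  → Pub
    }
    where
    Row : REL (Fin (suc m)) (Fin m) 0ℓ
    Row u i = (suc i ∈ A × u ∈ A × P u (f i)) ⊎ (suc i ∉ A × u ≡ suc i)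

    Column : REL (Fin m) (Fin n) 0ℓ
    Column i b = (suc i ∈ A × f i ≡ b) ⊎ (suc i ∉ A × P (suc i) b)

    through : ∀ {u b} → P u b → (Row ; Column) u b
    through {u} Pub with u ∈? A
    through {u} Pub | yes u∈A with closed u∈A Pub
    ... | i , i∈A , refl = i , inj₁ (i∈A , u∈A , Pub) , inj₁ (i∈A , refl)
    through {zero}  Pub | no 0∉A = contradiction 0∈A 0∉A
    through {suc i} Pub | no i∉A = i , inj₂ (i∉A , refl) , inj₂ (i∉A , Pub)

    diagonal : ∀ i → Row (suc i) i
    diagonal i with suc i ∈? A
    ... | yes i∈A = inj₁ (i∈A , i∈A , f-related i)
    ... | no  i∉A = inj₂ (i∉A , refl)

    column-total : ∀ i → ∃[ b ] Column i b
    column-total i with suc i ∈? A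
    ... | yes i∈A = f i , inj₁ (i∈A , refl)
    ... | no  i∉A = f i , inj₂ (i∉A , f-related i)

  -- Invariant: every row of `A` can be made the exempt one. An edge from `A` to a free column
  -- completes a matching; an edge to the column of a row outside `A` adds that row, which can
  -- happen only finitely often; without such edges there is a small cover.
  grow : (A : Subset (suc m)) → Acc _⊃_ A → zero ∈ A →
         (∀ {u} → u ∈ A → MatchingOff A u) → Matching P ⊎ SmallFactorisation P
  grow A (acc rec) 0∈A off
    with any? (λ u → any? λ b → u ∈? A ×-dec P? u b ×-dec
           ¬? (any? λ i → suc i ∈? A ×-dec f i ≟ b))
  ... | no  closed = inj₂ (factorise A 0∈A λ {u} {b} u∈A Pub →
        decidable-stable (any? λ i → suc i ∈? A ×-dec f i ≟ b)
          λ escapes → closed (u , b , u∈A , Pub , escapes))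
  ... | yes (u , b , u∈A , Pub , escapes) with any? (λ i → f i ≟ b)
  ...   | no  b∉f        = inj₁ (Reassign.complete (off u∈A) Pub b∉f)
  ...   | yes (i , fi≡b) =
    grow (A ∪ ⁅ suc i ⁆)
      (rec (p⊆p∪q _ , suc i , q⊆p∪q A _ (x∈⁅x⁆ (suc i)) , i∉A))
      (p⊆p∪q _ 0∈A) off′
    where
    i∉A : suc i ∉ A
    i∉A i∈A = escapes (i , i∈A , fi≡b)

    off′ : ∀ {v} → v ∈ A ∪ ⁅ suc i ⁆ → MatchingOff (A ∪ ⁅ suc i ⁆) v
    off′ v∈ with x∈p∪q⁻ A ⁅ suc i ⁆ v∈
    ... | inj₁ v∈A = weaken (p⊆p∪q _) (off v∈A)
    ... | inj₂ v∈i with refl ← x∈⁅y⁆⇒x≡y (suc i) v∈i =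
      Reassign.extend (off u∈A) Pub u∈A i∉A fi≡b

  augment : Matching P ⊎ SmallFactorisation P
  augment = grow ⁅ zero ⁆ (⊃-wellFounded _) (x∈⁅x⁆ zero)
    λ u∈0 → subst (MatchingOff _) (sym (x∈⁅y⁆⇒x≡y zero u∈0)) initial

-- The new row gets a middle point of its own, so the number of rows and the size both grow by one.
addRow : {P : REL (Fin (suc m)) (Fin n) 0ℓ} → Decidable P →
         (∀ u → ∃[ b ] P u b) →
         SmallFactorisation (P ∘ suc) → SmallFactorisation P
addRow {P = P} P? P-total F = record
  { size<m = s≤s size<m
  ; Q      = record
      { Related    = Row
      ; related?   = λ where
          zero    zero    → yes tt
          zero    (suc i) → no λ ()
          (suc u) zero    → no λ ()
          (suc u) (suc i) → related? Q u i
      ; fullDomain = λ where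
          zero    → zero , tt
          (suc u) → map suc id (fullDomain Q u)
      ; fullImage  = λ where
          zero    → zero , tt
          (suc i) → map suc id (fullImage Q i)
      }
  ; T      = Column
  ; T?     = λ where
      zero    → P? zero
      (suc i) → T? i
  ; total  = λ where
      zero    → P-total zero
      (suc i) → total i
  ; factor = (λ {u} → through u) , λ {u} → back u
  }
  where
  open SmallFactorisation F

  Row : REL (Fin (suc _)) (Fin (suc size)) 0ℓ
  Row zero    zero    = ⊤
  Row zero    (suc i) = ⊥
  Row (suc u) zero    = ⊥
  Row (suc u) (suc i) = Related Q u i

  Column : REL (Fin (suc size)) (Fin _) 0ℓ
  Column zero    = P zero
  Column (suc i) = T i

  through : ∀ u {b} → P u b → (Row ; Column) u b
  through zero    P0b = zero , tt , P0b
  through (suc u) Pub = map suc id (proj₁ factor Pub)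

  back : ∀ u {b} → (Row ; Column) u b → P u b
  back zero    (zero  , _   , P0b) = P0b
  back (suc u) (suc i , Qui , Tib) = proj₂ factor (i , Qui , Tib)

-- Induction on the number of rows: a matching of all rows but the first is augmented, a
-- factorisation is extended.
matching-or-factorisation :
  {P : REL (Fin m) (Fin n) 0ℓ} → Decidable P → (∀ u → ∃[ b ] P u b) →
  Matching P ⊎ SmallFactorisation P
matching-or-factorisation {m = zero} _ _ =
  inj₁ ((λ ()) , (λ { {()} }) , λ ())
matching-or-factorisation {m = suc m} P? P-total
  with matching-or-factorisation (P? ∘ suc) (P-total ∘ suc)
... | inj₁ (f , f-injective , f-related) =
  Augmentation.augment P? P-total f f-injective f-related
... | inj₂ F = inj₂ (addRow P? P-total F)

-- Composition of relations and smaller equivalent graphs.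

_⨾_ : FullRelation m n → FullRelation n p → FullRelation m p
Related    (R ⨾ S) = Related R ; Related S
related?   (R ⨾ S) u c = any? λ b → related? R u b ×-dec related? S b c
fullDomain (R ⨾ S) u = let b , Rub = fullDomain R u
                           c , Sbc = fullDomain S b
                       in c , b , Rub , Sbc
fullImage  (R ⨾ S) c = let b , Sbc = fullImage S c
                           a , Rab = fullImage R b
                       in a , b , Rab , Sbc

∗-⨾ : {G : Graph m} {H : Graph n} {K : Graph p}
      (R : FullRelation m n) (S : FullRelation n p) →
      G ∗ R ≐ H → H ∗ S ≐ K → G ∗ (R ⨾ S) ≐ K
∗-⨾ R S (to , from) (to′ , from′) =
    (λ (u , v , e , (a , Rua , Sa) , b , Rvb , Sb) →
       to′ (a , b , to (u , v , e , Rua , Rvb) , Sa , Sb))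
  , λ e → let a , b , e′ , Sa , Sb = from′ e
              u , v , e″ , Rua , Rvb = from e′
          in u , v , e″ , (a , Rua , Sa) , b , Rvb , Sb

-- The smaller graph is `G ∗ Q`. The way back to `G` runs through `H`, by `T` and then `S`.
smallFactorisation⇒smaller :
  {G : Graph m} {H : Graph n} (R : FullRelation m n) (S : FullRelation n m) →
  G ∗ R ≐ H → H ∗ S ≐ G → SmallFactorisation (Related R) →
  ∃[ k ] k < m × ∃[ K ] _WeaklyEquivalent_ {n = k} G K
smallFactorisation⇒smaller {G = G} {H} R S (to , from) G≐ F =
  size , size<m , G ∗ Q , (Q , id , id) , T′ ⨾ S ,
  ∗-⨾ {G = G ∗ Q} {H} {G} T′ S G∗Q∗T′≐H G≐
  where
  open SmallFactorisation F

  T′ : FullRelation size _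
  T′ = record
    { Related    = T
    ; related?   = T?
    ; fullDomain = total
    -- Some `u` is related to `b` by `R`, and that pair passes through a middle point.
    ; fullImage  = λ b → let u , Rub = fullImage R b
                             i , _ , Tib = proj₁ factor Rub
                         in i , Tib
    }

  G∗Q∗T′≐H : G ∗ Q ∗ T′ ≐ H
  G∗Q∗T′≐H =
      (λ (i , j , (u , v , e , Qui , Qvj) , Tia , Tjb) →
         to (u , v , e , proj₂ factor (i , Qui , Tia) , proj₂ factor (j , Qvj , Tjb)))
    , λ e → let u , v , e′ , Rua , Rvb = from e
                i , Qui , Tia = proj₁ factor Rua
                j , Qvj , Tjb = proj₁ factor Rvb
            in i , j , (u , v , e′ , Qui , Qvj) , Tia , Tjb

-- Injective homomorphisms and the isomorphism.

InjectiveHom : Graph m → Graph n → Set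
InjectiveHom G H = ∃[ f ] Injective _≡_ _≡_ f ×
  (∀ {u v} → Edge G u v → Edge H (f u) (f v))

-- Minimality of `G` rules out a small factorisation. The remaining injection lies inside `R`, so it
-- maps edges of `G` to edges of `G ∗ R`.
core⇒injectiveHom : (G : Graph m) (H : Graph n) → RCore G →
                    G WeaklyEquivalent H → InjectiveHom G H
core⇒injectiveHom G H core ((R , H≐) , (S , G≐))
  with matching-or-factorisation (related? R) (fullDomain R)
... | inj₁ (f , f-injective , f-related) =
  f , f-injective , λ {u} {v} e → proj₁ H≐ (u , v , e , f-related u , f-related v)
... | inj₂ F
  with k , k<m , K , G~K ← smallFactorisation⇒smaller {G = G} {H} R S H≐ G≐ F =
  contradiction (core K G~K) (<⇒≱ k<m)

injectiveHoms⇒≅ : (G : Graph m) (H : Graph n) →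
                  InjectiveHom G H → InjectiveHom H G → G ≅ H
injectiveHoms⇒≅ {m} {n} G H (f , f-inj , f-hom) (g , g-inj , g-hom) =
    permutation f f⁻¹ f-f⁻¹ (λ u → f-inj (f-f⁻¹ (f u)))
  , λ u v → mk⇔ f-hom (reflect ∘ g-hom)
  where
  returns : ∀ y → ∃[ l ] fold y (f ∘ g) (suc l) ≡ y
  returns = periodic (g-inj ∘ f-inj) {e = id} id

  f⁻¹ : Fin n → Fin m
  -- Stopping one application of `f` before the orbit of `y` under `f ∘ g` closes gives a preimage
  -- of `y`.
  f⁻¹ y = g (fold y (f ∘ g) (proj₁ (returns y)))

  f-f⁻¹ : ∀ y → f (f⁻¹ y) ≡ y
  f-f⁻¹ y = proj₂ (returns y)

  -- Acting on pairs makes both ends of an edge return after the same number of iterations.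
  gf² : Fin m × Fin m → Fin m × Fin m
  gf² (u , v) = g (f u) , g (f v)

  gf²-injective : Injective _≡_ _≡_ gf²
  gf²-injective eq = ×-≡,≡→≡
    (f-inj (g-inj (cong proj₁ eq)) , f-inj (g-inj (cong proj₂ eq)))

  reflect : ∀ {u v} → Edge G (g (f u)) (g (f v)) → Edge G u v
  reflect {u} {v} = reflects-invariant gf²-injective
    -- `combine` embeds the pairs into `Fin (m * m)`.
    {e = λ (u , v) → combine u v}
    (λ {(u , v)} {(u′ , v′)} eq → ×-≡,≡→≡ (combine-injective u v u′ v′ eq))
    {P = λ (u , v) → Edge G u v} (g-hom ∘ f-hom) {u , v}

proposition4p2p9 : ∀ {m n : ℕ} (G : Graph m) (H : Graph n) →
    RCore G → RCore H → G WeaklyEquivalent H → G ≅ H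
proposition4p2p9 G H G-core H-core (G→H , H→G) = injectiveHoms⇒≅ G H
  (core⇒injectiveHom G H G-core (G→H , H→G))
  (core⇒injectiveHom H G H-core (H→G , G→H))
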